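{- Let $q$ be a prime power, let $n\ge k\ge1$ be integers, let $\mathcal{C}$ be an $[n,k]_q$ code and let $c=(c_1,\dots,c_n)\in\mathcal{C}$ be a maximal codeword. For every $j\in\sigma(c)$ there exist a set $I_j\subseteq\sigma(c)\setminus\{j\}$ of cardinality $(q-1)(k-1)$ and a codeword $z\in\mathcal{C}$ such that $\sigma(z)\cap\sigma(c)\supseteq I_j$.
   Context: For $v\in\mathbb{F}_q^n$, the support is $\sigma(v)=\{i : v_i\ne 0\}\subseteq\{1,\dots,n\}$. An $[n,k]_q$ code is an $\mathbb{F}_q$-linear subspace $\mathcal{C}\subseteq\mathbb{F}_q^n$ of dimension $k\ge1$. A nonzero codeword $c\in\mathcal{C}$ is maximal if every $c'\in\mathcal{C}$ with $\sigma(c')\supseteq\sigma(c)$ is a scalar multiple of $c$. -}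

module Defs where

open import Algebra.Apartness.Bundles
  using (HeytingField; module HeytingCommutativeRing)
open import Algebra.Bundles using (CommutativeRing)
open import Data.Fin.Base using (Fin)
open import Data.Fin.Properties using (_≟_)
open import Data.Fin.Subset using (Subset; _⊆_)
open import Data.Nat.Base using (ℕ; _≥_; _^_)
open import Data.Nat.Primality using (Prime)
open import Data.Product.Base using (∃; ∃₂; ∃-syntax; _×_)
open import Data.Vec.Base using (tabulate)
open import Data.Vec.Functional using (Vector)
import Data.Vec.Functional.Relation.Binary.Equality.Setoid as VectorEquality
open import Function.Bundles using (Inverse)
open import Function.Properties.Inverse using (Inverse⇒Injection)
open import Level using (Level; suc; _⊔_)
open import Relation.Binary.Definitions using (Decidable)
open import Relation.Binary.PropositionalEquality using (_≡_; setoid)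
open import Relation.Nullary using (¬_; does; ¬?)
open import Relation.Nullary.Decidable using (via-injection)
open import Relation.Unary using (Pred)

PrimePower : ℕ → Set
PrimePower q = ∃₂ λ p m → Prime p × m ≥ 1 × q ≡ p ^ m

-- A field with exactly q elements up to _≈_.  Finiteness makes _≈_ decidable
-- and (by searching for inverses) the apartness of the Heyting field coincide
-- with inequality, so these are the usual finite fields.
record FiniteField c ℓ₁ ℓ₂ (q : ℕ) : Set (suc (c ⊔ ℓ₁ ⊔ ℓ₂)) where
  field
    heytingField : HeytingField c ℓ₁ ℓ₂

  commutativeRing : CommutativeRing c ℓ₁
  commutativeRing =
    HeytingCommutativeRing.commutativeRing
      (HeytingField.heytingCommutativeRing heytingField)

  field
    enumeration :
      Inverse (CommutativeRing.setoid commutativeRing) (setoid (Fin q))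

  _≈?_ : Decidable (CommutativeRing._≈_ commutativeRing)
  _≈?_ = via-injection (Inverse⇒Injection enumeration) _≟_

module Codes {c ℓ₁ ℓ₂ q} (𝔽 : FiniteField c ℓ₁ ℓ₂ q) where
  open FiniteField 𝔽 using (commutativeRing; _≈?_)
  open CommutativeRing commutativeRing
    using (Carrier; _≈_; _+_; _*_; 0#; +-monoid)
    renaming (setoid to ≈-setoid)
  open import Algebra.Properties.Monoid.Sum +-monoid using (sum)
  open VectorEquality ≈-setoid using (_≋_)

  infixl 6 _+ᵛ_
  infixr 7 _·_
  infix  4 _∈ᶜ_

  Word : ℕ → Set c
  Word n = Vector Carrier n

  0ᵛ : ∀ {n} → Word n
  0ᵛ i = 0#

  _+ᵛ_ : ∀ {n} → Word n → Word n → Word n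
  (v +ᵛ w) i = v i + w i

  _·_ : ∀ {n} → Carrier → Word n → Word n
  (a · v) i = a * v i

  combination : ∀ {n k} → Vector Carrier k → Vector (Word n) k → Word n
  combination a b i = sum (λ r → a r * b r i)

  σ : ∀ {n} → Word n → Subset n
  σ v = tabulate λ i → does (¬? (v i ≈? 0#))

  record IsSubspace {n p} (C : Pred (Word n) p) : Set (c ⊔ ℓ₁ ⊔ p) where
    field
      resp-≋    : ∀ {v w} → v ≋ w → C v → C w
      0-closed  : C 0ᵛ
      +-closed  : ∀ {v w} → C v → C w → C (v +ᵛ w)
      ·-closed  : ∀ a {v} → C v → C (a · v)

  record IsBasis {n k p} (C : Pred (Word n) p) (b : Vector (Word n) k)
         : Set (c ⊔ ℓ₁ ⊔ p) where
    field
      members     : ∀ r → C (b r)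
      spanning    : ∀ {v} → C v → ∃[ a ] v ≋ combination a b
      independent : ∀ a → combination a b ≋ 0ᵛ → ∀ r → a r ≈ 0#

  record Code (n k : ℕ) (p : Level) : Set (c ⊔ ℓ₁ ⊔ suc p) where
    field
      Codeword   : Pred (Word n) p
      isSubspace : IsSubspace Codeword
      dimension  : ∃ λ (b : Vector (Word n) k) → IsBasis Codeword b

  _∈ᶜ_ : ∀ {n k p} → Word n → Code n k p → Set p
  v ∈ᶜ C = Code.Codeword C v

  record Maximal {n k p} (C : Code n k p) (w : Word n) : Set (c ⊔ ℓ₁ ⊔ p) where
    field
      codeword : w ∈ᶜ C
      nonzero  : ¬ (w ≋ 0ᵛ)
      maximal  : ∀ {w′} → w′ ∈ᶜ C → σ w ⊆ σ w′ → ∃[ a ] w′ ≋ a · w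

{-# OPTIONS --safe #-}
-- Since z may be taken to be c itself, the claim is |σ(c) \ {j}| ≥ (q − 1)(k − 1),
-- a form of the Jamison / Brouwer–Schrijver bound on affine blocking sets.  The
-- codewords agreeing with c at j form an affine family v(x) = c + Σ xₛ dₛ with
-- x ∈ F^(k−1).  By maximality of c the product F(x) of the entries of v(x) over
-- σ(c) \ {j} vanishes for every x ≠ 0, while F(0) ≠ 0.  On the other hand there
-- are weights on the q elements of F, nonzero at 0, that annihilate t^e for all
-- e < q − 1; the product functional on F^(k−1) annihilates every product of fewer
-- than (q − 1)(k − 1) affine forms, yet takes a nonzero value at F.
module Submission where

open import Defs
open import Algebra.Apartness.Bundles using (HeytingField)
open import Algebra.Bundles using (CommutativeRing)
open import Data.Fin.Base using (Fin; zero; suc; punchIn)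
open import Data.Fin.Properties using (any?; punchIn-injective)
  renaming (_≟_ to _≟ᶠ_)
open import Data.Fin.Subset using (Subset; _∈_; _⊆_; _∩_; ∣_∣; ⊥; inside; outside)
  renaming (_-_ to infixl 5 _∖_)
open import Data.Fin.Subset.Properties
  using (p─q⊆p; x∈p∩q⁺; x∈p∧x≢y⇒x∈p-y; ∣⊥∣≡0; ∉⊥)
open import Data.List.Base using (List; []; _∷_; foldr; length; map)
open import Data.List.Membership.Propositional using () renaming (_∈_ to _∈ₗ_)
open import Data.List.Membership.Propositional.Properties using (∈-map⁺)
open import Data.List.Properties using (length-map)
import Data.List.Relation.Unary.All as All
import Data.List.Relation.Unary.All.Properties as Allₚ
import Data.List.Relation.Unary.Any as Any
open All using (All; []; _∷_)
open import Data.Nat.Base as ℕ using (ℕ; zero; suc; _∸_; _≥_; _≤_; _<_; s≤s)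
import Data.Nat.Properties as ℕ
open import Data.Product.Base using (∃-syntax; Σ-syntax; _×_; _,_; proj₁; proj₂)
open import Data.Vec.Base using ([]; _∷_; lookup; here; there)
open import Data.Vec.Functional as Vector using (Vector; head; tail; removeAt; insertAt)
open import Data.Vec.Functional.Properties using (insertAt-lookup; insertAt-punchIn)
import Data.Vec.Functional.Relation.Binary.Equality.Setoid as VectorEquality
open import Data.Vec.Properties using (lookup∘tabulate; lookup⇒[]=; []=⇒lookup)
open import Function.Base using (_∘_)
open import Function.Bundles using (Inverse)
open import Function.Definitions using (Injective)
open import Level using (Level; _⊔_)
open import Relation.Binary.PropositionalEquality as ≡ using (_≡_; _≢_)
open import Relation.Nullary using (¬_; Dec; does; yes; no; ¬?; contradiction)
open import Relation.Nullary.Decidable using (decidable-stable; dec-true; dec-false)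

-- Listing subsets and choosing subsets of a given size.

elements : ∀ {n} → Subset n → List (Fin n)
elements []            = []
elements (outside ∷ p) = map suc (elements p)
elements (inside  ∷ p) = zero ∷ map suc (elements p)

length-elements : ∀ {n} (p : Subset n) → length (elements p) ≡ ∣ p ∣
length-elements []            = ≡.refl
length-elements (outside ∷ p) = ≡.trans (length-map suc (elements p)) (length-elements p)
length-elements (inside  ∷ p) =
  ≡.cong suc (≡.trans (length-map suc (elements p)) (length-elements p))

∈-elements⁺ : ∀ {n} {p : Subset n} {i} → i ∈ p → i ∈ₗ elements p
∈-elements⁺ {p = inside  ∷ p} here        = Any.here ≡.refl
∈-elements⁺ {p = inside  ∷ p} (there i∈p) = Any.there (∈-map⁺ suc (∈-elements⁺ i∈p))
∈-elements⁺ {p = outside ∷ p} (there i∈p) = ∈-map⁺ suc (∈-elements⁺ i∈p)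

elements-⊆ : ∀ {n} (p : Subset n) → All (_∈ p) (elements p)
elements-⊆ []            = []
elements-⊆ (outside ∷ p) = Allₚ.gmap⁺ there (elements-⊆ p)
elements-⊆ (inside  ∷ p) = here ∷ Allₚ.gmap⁺ there (elements-⊆ p)

subset-of-size : ∀ {n} (p : Subset n) s → s ≤ ∣ p ∣ → ∃[ I ] I ⊆ p × ∣ I ∣ ≡ s
subset-of-size {n} p zero _ = ⊥ , (λ i∈⊥ → contradiction i∈⊥ ∉⊥) , ∣⊥∣≡0 n
subset-of-size (outside ∷ p) (suc s) s≤p with subset-of-size p (suc s) s≤p
... | I , I⊆p , ∣I∣ = outside ∷ I , (λ { (there i∈I) → there (I⊆p i∈I) }) , ∣I∣
subset-of-size (inside ∷ p) (suc s) (s≤s s≤p) with subset-of-size p s s≤p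
... | I , I⊆p , ∣I∣ =
  inside ∷ I , (λ { here → here ; (there i∈I) → there (I⊆p i∈I) }) , ≡.cong suc ∣I∣

-- Fields as nontrivial commutative rings with inverses.

Nontrivial : ∀ {c ℓ} → CommutativeRing c ℓ → Set ℓ
Nontrivial R = ¬ 1# ≈ 0#
  where open CommutativeRing R

-- Inverses are asked for under failure of equality with zero, not under apartness, so the
-- polynomial argument below speaks of ring equality alone.
HasInverses : ∀ {c ℓ} → CommutativeRing c ℓ → Set (c ⊔ ℓ)
HasInverses R = ∀ {x} → ¬ x ≈ 0# → ∃[ y ] y * x ≈ 1#
  where open CommutativeRing R

module PuncturedGrid {c ℓ} (R : CommutativeRing c ℓ)
  (1≉0 : Nontrivial R) (inverse : HasInverses R) where

  open CommutativeRing R hiding (zero)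
  open import Algebra.Properties.Semiring.Sum semiring
  open import Algebra.Properties.Semiring.Exp semiring using (_^_)
  open import Algebra.Properties.Ring ring using (x∙y⁻¹≈ε⇒x≈y)
  open import Algebra.Properties.CommutativeSemigroup *-commutativeSemigroup
    using (x∙yz≈y∙xz)
  open import Algebra.Solver.Ring.NaturalCoefficients.Default commutativeSemiring
    using (solve; _:=_; _:+_; _:*_; con)
  open import Relation.Binary.Reasoning.Setoid setoid
  open VectorEquality setoid using (_≋_)

  *-nonzero : ∀ {x y} → ¬ x ≈ 0# → ¬ y ≈ 0# → ¬ x * y ≈ 0#
  *-nonzero {x} {y} x≉0 y≉0 xy≈0 with inverse x≉0
  ... | x⁻¹ , x⁻¹x≈1 = y≉0 (begin
    y              ≈⟨ *-identityˡ y ⟨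
    1# * y         ≈⟨ *-congʳ x⁻¹x≈1 ⟨
    x⁻¹ * x * y    ≈⟨ *-assoc x⁻¹ x y ⟩
    x⁻¹ * (x * y)  ≈⟨ *-congˡ xy≈0 ⟩
    x⁻¹ * 0#       ≈⟨ zeroʳ x⁻¹ ⟩
    0#             ∎)

  xy≈y⇒x≈1 : ∀ {x y} → ¬ y ≈ 0# → x * y ≈ y → x ≈ 1#
  xy≈y⇒x≈1 {x} {y} y≉0 xy≈y with inverse y≉0
  ... | y⁻¹ , y⁻¹y≈1 = begin
    x              ≈⟨ *-identityʳ x ⟨
    x * 1#         ≈⟨ *-congˡ y⁻¹y≈1 ⟨
    x * (y⁻¹ * y)  ≈⟨ x∙yz≈y∙xz x y⁻¹ y ⟩
    y⁻¹ * (x * y)  ≈⟨ *-congˡ xy≈y ⟩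
    y⁻¹ * y        ≈⟨ y⁻¹y≈1 ⟩
    1#             ∎

  sum-zero : ∀ {n} (f : Vector Carrier n) → (∀ i → f i ≈ 0#) → sum f ≈ 0#
  sum-zero {zero}  f f≈0 = refl
  sum-zero {suc n} f f≈0 =
    trans (+-cong (f≈0 zero) (sum-zero (tail f) (f≈0 ∘ suc))) (+-identityˡ 0#)

  -- Weights that annihilate low powers.

  moment : ∀ {n} → Vector Carrier n → Vector Carrier n → ℕ → Carrier
  moment w t e = sum (λ i → w i * t i ^ e)

  moment-0 : ∀ {n} (w t : Vector Carrier n) → moment w t 0 ≈ sum w
  moment-0 w t = sum-cong-≋ λ i → *-identityʳ (w i)

  -- Split one factor `r i` as `s + (r i - s)`: the difference cancels the division by which `v`
  -- arose from `w`.
  moment-suc : ∀ {n} (w v r : Vector Carrier n) s → (∀ i → v i * (r i - s) ≈ w i) →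
    ∀ e → moment v r (suc e) ≈ s * moment v r e + moment w r e
  moment-suc w v r s v[r-s]≈w e = begin
    moment v r (suc e)
      ≈⟨ sum-cong-≋ (λ i → term i) ⟩
    sum (λ i → s * (v i * r i ^ e) + w i * r i ^ e)
      ≈⟨ ∑-distrib-+ (λ i → s * (v i * r i ^ e)) (λ i → w i * r i ^ e) ⟩
    sum (λ i → s * (v i * r i ^ e)) + moment w r e
      ≈⟨ +-congʳ (*-distribˡ-sum s (λ i → v i * r i ^ e)) ⟨
    s * moment v r e + moment w r e ∎
    where
    term : ∀ i → v i * (r i * r i ^ e) ≈ s * (v i * r i ^ e) + w i * r i ^ e
    term i = begin
      v i * (r i * p)                    ≈⟨ *-congˡ (*-congʳ r≈) ⟩
      v i * ((s + (r i - s)) * p)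
        ≈⟨ solve 4 (λ v s d p → v :* ((s :+ d) :* p) := s :* (v :* p) :+ v :* d :* p)
             refl (v i) s (r i - s) p ⟩
      s * (v i * p) + v i * (r i - s) * p ≈⟨ +-congˡ (*-congʳ (v[r-s]≈w i)) ⟩
      s * (v i * p) + w i * p            ∎
      where
      p = r i ^ e
      r≈ : r i ≈ s + (r i - s)
      r≈ = sym (begin
        s + (r i - s)    ≈⟨ solve 3 (λ s r m → s :+ (r :+ m) := r :+ (s :+ m)) refl s (r i) (- s) ⟩
        r i + (s - s)    ≈⟨ +-congˡ (-‿inverseʳ s) ⟩
        r i + 0#         ≈⟨ +-identityʳ (r i) ⟩
        r i              ∎)

  -- The coefficients of a divided difference: a new node s is added by dividing
  -- the weight of each old node r by r − s and balancing the total weight at s.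
  annihilating-weights : ∀ N (t : Vector Carrier (suc N)) → Injective _≡_ _≈_ t →
    ∃[ w ] ¬ w zero ≈ 0# × (∀ e → e < N → moment w t e ≈ 0#)
  annihilating-weights zero    t t-inj = (λ _ → 1#) , 1≉0 , λ _ ()
  annihilating-weights (suc N) t t-inj = w′ , w′₀≉0 , annihilates
    where
    s : Carrier
    s = t (suc zero)

    -- Dropping the node at index one, not the first, keeps `t zero` at the head, so the nonzero
    -- weight there survives the induction.
    r : Vector Carrier (suc N)
    r = removeAt t (suc zero)

    ih = annihilating-weights N r λ ri≈rj → punchIn-injective (suc zero) _ _ (t-inj ri≈rj)

    w : Vector Carrier (suc N)
    w = proj₁ ih

    r-s≉0 : ∀ i → ¬ r i - s ≈ 0#
    r-s≉0 i eq = punchIn≢ i (t-inj (x∙y⁻¹≈ε⇒x≈y (r i) s eq))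
      where
      punchIn≢ : ∀ i → punchIn (suc zero) i ≢ suc zero
      punchIn≢ zero    ()
      punchIn≢ (suc i) ()

    δ : Vector Carrier (suc N)
    δ i = proj₁ (inverse (r-s≉0 i))

    v : Vector Carrier (suc N)
    v i = w i * δ i

    v[r-s]≈w : ∀ i → v i * (r i - s) ≈ w i
    v[r-s]≈w i = trans (*-assoc (w i) (δ i) _)
      (trans (*-congˡ (proj₂ (inverse (r-s≉0 i)))) (*-identityʳ (w i)))

    w′ : Vector Carrier (suc (suc N))
    w′ zero          = v zero
    w′ (suc zero)    = - sum v
    w′ (suc (suc i)) = v (suc i)

    w′₀≉0 : ¬ v zero ≈ 0#
    w′₀≉0 = *-nonzero (proj₁ (proj₂ ih)) λ δ≈0 →
      1≉0 (trans (sym (proj₂ (inverse (r-s≉0 zero)))) (trans (*-congʳ δ≈0) (zeroˡ _)))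

    moment-split : ∀ e → moment w′ t e ≈ - sum v * s ^ e + moment v r e
    moment-split e = solve 3 (λ x y z → x :+ (y :+ z) := y :+ (x :+ z)) refl
      (v zero * t zero ^ e) (- sum v * s ^ e) (sum (λ i → v (suc i) * r (suc i) ^ e))

    annihilates : ∀ e → e < suc N → moment w′ t e ≈ 0#
    annihilates zero    _         = begin
      moment w′ t zero            ≈⟨ moment-split zero ⟩
      - sum v * 1# + moment v r 0 ≈⟨ +-cong (*-identityʳ _) (moment-0 v r) ⟩
      - sum v + sum v             ≈⟨ -‿inverseˡ (sum v) ⟩
      0#                          ∎
    -- The new node obeys the same recurrence as the old ones, up to the term `moment w r e`, which
    -- is zero by induction on the nodes. Vanishing thus climbs from the balanced total weight at
    -- exponent zero.
    annihilates (suc e) (s≤s e<N) = begin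
      moment w′ t (suc e)
        ≈⟨ moment-split (suc e) ⟩
      - sum v * (s * s ^ e) + moment v r (suc e)
        ≈⟨ +-congˡ (moment-suc w v r s v[r-s]≈w e) ⟩
      - sum v * (s * s ^ e) + (s * moment v r e + moment w r e)
        ≈⟨ solve 5 (λ σ s p m w → σ :* (s :* p) :+ (s :* m :+ w) := s :* (σ :* p :+ m) :+ w)
             refl (- sum v) s (s ^ e) (moment v r e) (moment w r e) ⟩
      s * (- sum v * s ^ e + moment v r e) + moment w r e
        ≈⟨ +-cong (*-congˡ (sym (moment-split e))) (proj₂ (proj₂ ih) e e<N) ⟩
      s * moment w′ t e + 0#
        ≈⟨ +-identityʳ _ ⟩
      s * moment w′ t e
        ≈⟨ *-congˡ (annihilates e (ℕ.m≤n⇒m≤1+n e<N)) ⟩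
      s * 0#
        ≈⟨ zeroʳ s ⟩
      0# ∎

  -- Products of affine forms.

  Form : ℕ → Set c
  Form m = Carrier × Vector Carrier m

  ⟦_⟧ : ∀ {m} → Form m → Vector Carrier m → Carrier
  ⟦ a , b ⟧ x = a + sum (λ i → x i * b i)

  ∏ : ∀ {m} → List (Form m) → Vector Carrier m → Carrier
  ∏ ls x = foldr (λ l p → ⟦ l ⟧ x * p) 1# ls

  ⟦⟧-cong : ∀ {m} (l : Form m) {x y} → x ≋ y → ⟦ l ⟧ x ≈ ⟦ l ⟧ y
  ⟦⟧-cong l x≋y = +-congˡ (sum-cong-≋ λ i → *-congʳ (x≋y i))

  ∏-cong : ∀ {m} (ls : List (Form m)) {x y} → x ≋ y → ∏ ls x ≈ ∏ ls y
  ∏-cong []       x≋y = refl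
  ∏-cong (l ∷ ls) x≋y = *-cong (⟦⟧-cong l x≋y) (∏-cong ls x≋y)

  ∏-nonzero⁺ : ∀ {m} {ls : List (Form m)} {x} →
    All (λ l → ¬ ⟦ l ⟧ x ≈ 0#) ls → ¬ ∏ ls x ≈ 0#
  ∏-nonzero⁺ []          = 1≉0
  ∏-nonzero⁺ (l≉0 ∷ ls≉0) = *-nonzero l≉0 (∏-nonzero⁺ ls≉0)

  ∏-nonzero⁻ : ∀ {m} (ls : List (Form m)) {x} →
    ¬ ∏ ls x ≈ 0# → All (λ l → ¬ ⟦ l ⟧ x ≈ 0#) ls
  ∏-nonzero⁻ []       _   = []
  ∏-nonzero⁻ (l ∷ ls) p≉0 =
    (λ l≈0 → p≉0 (trans (*-congʳ l≈0) (zeroˡ _))) ∷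
    ∏-nonzero⁻ ls (λ q≈0 → p≉0 (trans (*-congˡ q≈0) (zeroʳ _)))

  -- The product functional on a grid.

  module Functional {M} (w t : Vector Carrier M) where

    -- This is the `m`-fold tensor power of the weighted sum over the nodes `t`.
    W : ∀ m → (Vector Carrier m → Carrier) → Carrier
    W zero    f = f Vector.[]
    W (suc m) f = sum (λ i → w i * W m (λ x → f (t i Vector.∷ x)))

    W-cong : ∀ m {f g} → (∀ x → f x ≈ g x) → W m f ≈ W m g
    W-cong zero    f≈g = f≈g _
    W-cong (suc m) {f} {g} f≈g = sum-cong-≋ step
      where
      step : ∀ i → w i * W m (λ x → f (t i Vector.∷ x)) ≈ w i * W m (λ x → g (t i Vector.∷ x))
      step i = *-congˡ (W-cong m λ x → f≈g (t i Vector.∷ x))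

    W-+ : ∀ m f g → W m (λ x → f x + g x) ≈ W m f + W m g
    W-+ zero    f g = refl
    W-+ (suc m) f g = begin
      sum (λ i → w i * W m (λ x → fᵢ i x + gᵢ i x))
        ≈⟨ sum-cong-≋ (λ i → trans (*-congˡ (W-+ m (fᵢ i) (gᵢ i))) (distribˡ (w i) _ _)) ⟩
      sum (λ i → w i * W m (fᵢ i) + w i * W m (gᵢ i))
        ≈⟨ ∑-distrib-+ (λ i → w i * W m (fᵢ i)) (λ i → w i * W m (gᵢ i)) ⟩
      W (suc m) f + W (suc m) g ∎
      where
      fᵢ gᵢ : Fin M → Vector Carrier m → Carrier
      fᵢ i x = f (t i Vector.∷ x)
      gᵢ i x = g (t i Vector.∷ x)

    W-* : ∀ m a f → W m (λ x → a * f x) ≈ a * W m f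
    W-* zero    a f = refl
    W-* (suc m) a f = begin
      sum (λ i → w i * W m (λ x → a * fᵢ i x))
        ≈⟨ sum-cong-≋ (λ i → trans (*-congˡ (W-* m a (fᵢ i))) (x∙yz≈y∙xz (w i) a _)) ⟩
      sum (λ i → a * (w i * W m (fᵢ i)))
        ≈⟨ *-distribˡ-sum a (λ i → w i * W m (fᵢ i)) ⟨
      a * W (suc m) f ∎
      where
      fᵢ : Fin M → Vector Carrier m → Carrier
      fᵢ i x = f (t i Vector.∷ x)

    W-0 : ∀ m {f} → (∀ x → f x ≈ 0#) → W m f ≈ 0#
    W-0 m {f} f≈0 = begin
      W m f                 ≈⟨ W-cong m (λ x → trans (f≈0 x) (sym (zeroˡ _))) ⟩
      W m (λ x → 0# * f x)  ≈⟨ W-* m 0# f ⟩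
      0# * W m f            ≈⟨ zeroˡ _ ⟩
      0#                    ∎

    module _ {N} (w-ann : ∀ e → e < N → moment w t e ≈ 0#) where

      -- A monomial of degree below `m * N` in `m` variables has some exponent below `N`, and the
      -- moment in that variable kills it. Peeling off one variable at a time avoids writing out
      -- monomials.
      W-∏ : ∀ m (ls : List (Form m)) → length ls < m ℕ.* N → W m (∏ ls) ≈ 0#

      -- Each form in ms is expanded in turn as a form in the remaining
      -- variables plus a multiple of the first variable.
      W-expand : ∀ m e (ls : List (Form m)) (ms : List (Form (suc m))) →
        e ℕ.+ (length ls ℕ.+ length ms) < suc m ℕ.* N →
        W (suc m) (λ y → head y ^ e * (∏ ls (tail y) * ∏ ms y)) ≈ 0#

      W-∏ zero    _  ()
      W-∏ (suc m) ms ms<N = trans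
        (W-cong (suc m) λ y → solve 1 (λ p → p := con 1 :* (con 1 :* p)) refl (∏ ms y))
        (W-expand m 0 [] ms ms<N)

      W-expand m e ls [] h = begin
        sum (λ i → w i * W m (λ x → t i ^ e * (∏ ls x * 1#)))
          ≈⟨ sum-cong-≋ pull-out ⟩
        sum (λ i → w i * t i ^ e * W m (∏ ls))
          ≈⟨ *-distribʳ-sum (W m (∏ ls)) (λ i → w i * t i ^ e) ⟨
        moment w t e * W m (∏ ls)
          ≈⟨ zero-factor (e ℕ.<? N) ⟩
        0# ∎
        where
        pull-out : ∀ i → w i * W m (λ x → t i ^ e * (∏ ls x * 1#)) ≈ w i * t i ^ e * W m (∏ ls)
        pull-out i = begin
          w i * W m (λ x → t i ^ e * (∏ ls x * 1#))
            ≈⟨ *-congˡ (W-* m (t i ^ e) (λ x → ∏ ls x * 1#)) ⟩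
          w i * (t i ^ e * W m (λ x → ∏ ls x * 1#))
            ≈⟨ *-congˡ (*-congˡ (W-cong m λ x → *-identityʳ (∏ ls x))) ⟩
          w i * (t i ^ e * W m (∏ ls))
            ≈⟨ *-assoc (w i) (t i ^ e) (W m (∏ ls)) ⟨
          w i * t i ^ e * W m (∏ ls) ∎

        h′ : e ℕ.+ length ls < N ℕ.+ m ℕ.* N
        h′ = ≡.subst (λ l → e ℕ.+ l < N ℕ.+ m ℕ.* N) (ℕ.+-identityʳ (length ls)) h

        -- A small exponent is killed by the weights. Otherwise the first variable has used up at
        -- least `N` of the degree bound, leaving fewer than `m * N` forms for the induction on `m`.
        zero-factor : Dec (e < N) → moment w t e * W m (∏ ls) ≈ 0#
        zero-factor (yes e<N) = trans (*-congʳ (w-ann e e<N)) (zeroˡ _)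
        zero-factor (no  e≮N) = trans (*-congˡ (W-∏ m ls ls<)) (zeroʳ _)
          where
          ls< : length ls < m ℕ.* N
          ls< = ℕ.+-cancelˡ-< N _ _
            (ℕ.≤-<-trans (ℕ.+-monoˡ-≤ (length ls) (ℕ.≮⇒≥ e≮N)) h′)
      W-expand m e ls ((a , b) ∷ ms) h = begin
        W (suc m) (λ y → head y ^ e * (∏ ls (tail y) * (⟦ a , b ⟧ y * ∏ ms y)))
          ≈⟨ W-cong (suc m) (λ y → solve 7
               (λ p L M a x b S → p :* (L :* ((a :+ (x :* b :+ S)) :* M)) :=
                  p :* ((a :+ S) :* L :* M) :+ b :* (x :* p :* (L :* M)))
               refl (head y ^ e) (∏ ls (tail y)) (∏ ms y) a (head y) (head b)
               (sum (λ i → tail y i * tail b i))) ⟩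
        W (suc m) (λ y → f y + head b * g y)
          ≈⟨ W-+ (suc m) f (λ y → head b * g y) ⟩
        W (suc m) f + W (suc m) (λ y → head b * g y)
          -- One summand lengthens `ls`, the other raises `e`; either way `ms` shortens and the
          -- total `e + (length ls + length ms)` is preserved.
          ≈⟨ +-cong
               (W-expand m e ((a , tail b) ∷ ls) ms
                 (≡.subst (λ l → e ℕ.+ l < suc m ℕ.* N) (ℕ.+-suc (length ls) (length ms)) h))
               (W-* (suc m) (head b) g) ⟩
        0# + head b * W (suc m) g
          ≈⟨ +-identityˡ _ ⟩
        head b * W (suc m) g
          ≈⟨ *-congˡ (W-expand m (suc e) ls ms
               (≡.subst (_< suc m ℕ.* N)
                 (≡.trans (≡.cong (e ℕ.+_) (ℕ.+-suc (length ls) (length ms))) (ℕ.+-suc e _)) h)) ⟩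
        head b * 0#
          ≈⟨ zeroʳ _ ⟩
        0# ∎
        where
        f g : Vector Carrier (suc m) → Carrier
        f y = head y ^ e * (∏ ((a , tail b) ∷ ls) (tail y) * ∏ ms y)
        g y = head y ^ suc e * (∏ ls (tail y) * ∏ ms y)

  -- Covering all points but the origin.

  module _ {N} (w t : Vector Carrier (suc N)) (w₀≉0 : ¬ w zero ≈ 0#)
           (t₀≈0 : t zero ≈ 0#) (t≉0 : ∀ i → ¬ t (suc i) ≈ 0#) where

    open Functional w t

    -- Only the origin contributes, so the value is `f` at the origin times the `m`-th power of
    -- `w zero`. Since points are functions, `f-cong` is what identifies the grid point with all
    -- coordinates `t zero` with the origin.
    W-punctured : ∀ m (f : Vector Carrier m → Carrier) →
      (∀ {x y} → x ≋ y → f x ≈ f y) →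
      (∀ x → ¬ x ≋ (λ _ → 0#) → f x ≈ 0#) →
      ¬ f (λ _ → 0#) ≈ 0# → ¬ W m f ≈ 0#
    W-punctured zero    f f-cong f≈0 f0≉0 = f0≉0 ∘ trans (f-cong λ ())
    W-punctured (suc m) f f-cong f≈0 f0≉0 Wf≈0 = *-nonzero w₀≉0
      (W-punctured m (λ x → f (t zero Vector.∷ x))
        (λ x≋y → f-cong λ { zero → refl ; (suc i) → x≋y i })
        (λ x x≉0 → f≈0 _ λ tx≋0 → x≉0 (tx≋0 ∘ suc))
        (f0≉0 ∘ trans (f-cong λ { zero → sym t₀≈0 ; (suc i) → refl })))
      (begin
        w₀W                ≈⟨ +-identityʳ _ ⟨
        w₀W + 0#           ≈⟨ +-congˡ rest≈0 ⟨
        W (suc m) f        ≈⟨ Wf≈0 ⟩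
        0#                 ∎)
      where
      w₀W = w zero * W m (λ x → f (t zero Vector.∷ x))
      rest≈0 : sum (λ i → w (suc i) * W m (λ x → f (t (suc i) Vector.∷ x))) ≈ 0#
      rest≈0 = sum-zero (λ i → w (suc i) * W m (λ x → f (t (suc i) Vector.∷ x))) λ i → trans
        (*-congˡ (W-0 m λ x → f≈0 _ λ tx≋0 → t≉0 i (tx≋0 zero)))
        (zeroʳ _)

  -- With fewer than `m * N` forms, `W-∏` would make the functional vanish on their product, against
  -- `W-punctured`.
  punctured-cover-bound : ∀ {N} (t : Vector Carrier (suc N)) → Injective _≡_ _≈_ t →
    t zero ≈ 0# → ∀ m (ls : List (Form m)) →
    (∀ x → ¬ x ≋ (λ _ → 0#) → ∏ ls x ≈ 0#) →
    ¬ ∏ ls (λ _ → 0#) ≈ 0# → m ℕ.* N ≤ length ls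
  punctured-cover-bound {N} t t-inj t₀≈0 m ls vanish ∏0≉0
    with annihilating-weights N t t-inj
  ... | w , w₀≉0 , w-ann = ℕ.≮⇒≥ λ ls< →
    W-punctured w t w₀≉0 t₀≈0 t≉0 m (∏ ls) (∏-cong ls) vanish ∏0≉0 (W-∏ w-ann m ls ls<)
    where
    open Functional w t
    t≉0 : ∀ i → ¬ t (suc i) ≈ 0#
    t≉0 i ti≈0 with t-inj (trans ti≈0 (sym t₀≈0))
    ... | ()

-- Finite fields satisfy the field axioms used above.

module FiniteFieldProperties {c ℓ₁ ℓ₂ q} (𝔽 : FiniteField c ℓ₁ ℓ₂ q) where
  open FiniteField 𝔽
  open CommutativeRing commutativeRing hiding (zero)
  open HeytingField heytingField using (tight; #⇒invertible)
  open Inverse enumeration using (to; from; to-cong; strictlyInverseˡ; strictlyInverseʳ)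
  open import Algebra.Apartness.Properties.HeytingCommutativeRing
    (HeytingField.heytingCommutativeRing heytingField) using (1#0; x-0≈x)

  1≉0 : ¬ 1# ≈ 0#
  1≉0 1≈0 = proj₂ (tight 1# 0#) 1≈0 1#0

  -- Apartness comes with no decision procedure, so an inverse is searched for through the
  -- enumeration. If the search fails, `x` is not apart from zero, and tightness forces it to be
  -- zero.
  inverse : ∀ {x} → ¬ x ≈ 0# → ∃[ y ] y * x ≈ 1#
  inverse {x} x≉0 with any? (λ i → (from i * x) ≈? 1#)
  ... | yes (i , ix≈1) = from i , ix≈1
  ... | no  none       = contradiction (proj₁ (tight x 0#) ¬x#0) x≉0
    where
    ¬x#0 : ¬ HeytingField._#_ heytingField x 0#
    ¬x#0 x#0 with #⇒invertible x#0
    ... | y , yx≈1 , _ = none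
      (to y , trans (*-cong (strictlyInverseʳ y) (sym (x-0≈x x))) yx≈1)

  from-injective : Injective _≡_ _≈_ from
  from-injective {i} {j} eq =
    ≡.trans (≡.sym (strictlyInverseˡ i)) (≡.trans (to-cong eq) (strictlyInverseˡ j))

-- The affine family of codewords through a maximal codeword.

module SupportBound {a ℓ₁ ℓ₂ N} (𝔽 : FiniteField a ℓ₁ ℓ₂ (suc N)) where
  open FiniteField 𝔽
  open CommutativeRing commutativeRing hiding (zero)
    renaming (setoid to ≈-setoid)
  open FiniteFieldProperties 𝔽
  open Inverse enumeration using (from)
  open Codes 𝔽
  open PuncturedGrid commutativeRing 1≉0 inverse
  open VectorEquality ≈-setoid using (_≋_)
  open import Algebra.Properties.Ring ring using (+-cancelʳ; +-cancelˡ)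
  open import Algebra.Properties.Semiring.Sum semiring
  open import Algebra.Solver.Ring.NaturalCoefficients.Default commutativeSemiring
    using (solve; _:=_; _:+_; _:*_)
  open import Relation.Binary.Reasoning.Setoid ≈-setoid

  lookup-σ : ∀ {n} (v : Word n) i → lookup (σ v) i ≡ does (¬? (v i ≈? 0#))
  lookup-σ v = lookup∘tabulate (λ i → does (¬? (v i ≈? 0#)))

  ∈σ⁺ : ∀ {n} (v : Word n) {i} → ¬ v i ≈ 0# → i ∈ σ v
  ∈σ⁺ v {i} vi≉0 = lookup⇒[]= i (σ v)
    (≡.trans (lookup-σ v i) (dec-true (¬? (v i ≈? 0#)) vi≉0))

  ∈σ⁻ : ∀ {n} (v : Word n) {i} → i ∈ σ v → ¬ v i ≈ 0#
  ∈σ⁻ v {i} i∈σ vi≈0 with () ←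
    ≡.trans (≡.sym ([]=⇒lookup i∈σ))
      (≡.trans (lookup-σ v i) (dec-false (¬? (v i ≈? 0#)) λ vi≉0 → vi≉0 vi≈0))

  combination-closed : ∀ {n p} {C : Word n → Set p} → IsSubspace C →
    ∀ {k} (x : Vector Carrier k) (d : Vector (Word n) k) → (∀ s → C (d s)) →
    C (combination x d)
  combination-closed S {zero}  x d d∈C = IsSubspace.0-closed S
  combination-closed S {suc k} x d d∈C = IsSubspace.+-closed S
    (IsSubspace.·-closed S (head x) (d∈C zero))
    (combination-closed S (tail x) (tail d) (d∈C ∘ suc))

  module _ {n m p} (C : Code n (suc m) p) (c : Word n) (c-max : Maximal C c)
           (j : Fin n) (j∈σc : j ∈ σ c) where
    open Code C
    open IsSubspace isSubspace
    open Maximal c-max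

    b : Vector (Word n) (suc m)
    b = proj₁ dimension

    open IsBasis (proj₂ dimension)

    cⱼ≉0 : ¬ c j ≈ 0#
    cⱼ≉0 = ∈σ⁻ c j∈σc

    -- If all basis words vanished at `j`, so would `c`, which they span.
    pivot : ∃[ r ] ¬ b r j ≈ 0#
    pivot with any? (λ r → ¬? (b r j ≈? 0#))
    ... | yes found = found
    ... | no  none  = contradiction cⱼ≈0 cⱼ≉0
      where
      bⱼ≈0 : ∀ r → b r j ≈ 0#
      bⱼ≈0 r = decidable-stable (b r j ≈? 0#) λ brj≉0 → none (r , brj≉0)

      cⱼ≈0 : c j ≈ 0#
      cⱼ≈0 = trans (proj₂ (spanning codeword) j)
        (sum-zero (λ r → y r * b r j) λ r → trans (*-congˡ (bⱼ≈0 r)) (zeroʳ _))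
        where y = proj₁ (spanning codeword)

    r : Fin (suc m)
    r = proj₁ pivot

    β : Carrier
    β = proj₁ (inverse (proj₂ pivot))

    γ : Vector Carrier m
    γ s = - (b (punchIn r s) j) * β

    -- Gaussian elimination with pivot r makes the entries at j vanish.
    d : Vector (Word n) m
    d s = b (punchIn r s) +ᵛ γ s · b r

    d∈C : ∀ s → d s ∈ᶜ C
    d∈C s = +-closed (members _) (·-closed _ (members r))

    dⱼ≈0 : ∀ s → d s j ≈ 0#
    dⱼ≈0 s = begin
      y + - y * β * b r j    ≈⟨ +-congˡ (*-assoc _ _ _) ⟩
      y + - y * (β * b r j)  ≈⟨ +-congˡ (*-congˡ (proj₂ (inverse (proj₂ pivot)))) ⟩
      y + - y * 1#           ≈⟨ +-congˡ (*-identityʳ _) ⟩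
      y + - y                ≈⟨ -‿inverseʳ y ⟩
      0#                     ∎
      where y = b (punchIn r s) j

    -- A combination of the `d s` is a combination of the basis with the coefficients `x` off the
    -- pivot; `α` collects the multiples of `b r` introduced by the elimination.
    d-independent : ∀ x → combination x d ≋ 0ᵛ → x ≋ (λ _ → 0#)
    d-independent x xd≋0 s = trans
      (reflexive (≡.sym (insertAt-punchIn x r α s)))
      (independent x⁺ (λ i → trans (x⁺b i) (xd≋0 i)) (punchIn r s))
      where
      α : Carrier
      α = sum (λ s → x s * γ s)

      x⁺ : Vector Carrier (suc m)
      x⁺ = insertAt x r α

      x⁺b : combination x⁺ b ≋ combination x d
      x⁺b i = begin
        sum (λ s → x⁺ s * b s i)
          ≈⟨ sum-remove {i = r} (λ s → x⁺ s * b s i) ⟩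
        x⁺ r * b r i + sum (λ s → x⁺ (punchIn r s) * b (punchIn r s) i)
          ≈⟨ +-cong
               (*-congʳ (reflexive (insertAt-lookup x r α)))
               (sum-cong-≋ λ s → *-congʳ (reflexive (insertAt-punchIn x r α s))) ⟩
        α * b r i + sum (λ s → x s * b (punchIn r s) i)
          ≈⟨ +-congʳ (*-distribʳ-sum (b r i) (λ s → x s * γ s)) ⟩
        sum (λ s → x s * γ s * b r i) + sum (λ s → x s * b (punchIn r s) i)
          ≈⟨ ∑-distrib-+ (λ s → x s * γ s * b r i) (λ s → x s * b (punchIn r s) i) ⟨
        sum (λ s → x s * γ s * b r i + x s * b (punchIn r s) i)
          ≈⟨ sum-cong-≋ (λ s → solve 4
               (λ x γ y z → x :* γ :* y :+ x :* z := x :* (z :+ γ :* y))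
               refl (x s) (γ s) (b r i) (b (punchIn r s) i)) ⟩
        combination x d i ∎

    v : Vector Carrier m → Word n
    v x = c +ᵛ combination x d

    v∈C : ∀ x → v x ∈ᶜ C
    v∈C x = +-closed codeword (combination-closed isSubspace x d d∈C)

    vⱼ≈cⱼ : ∀ x → v x j ≈ c j
    vⱼ≈cⱼ x = trans
      (+-congˡ (sum-zero (λ s → x s * d s j) λ s → trans (*-congˡ (dⱼ≈0 s)) (zeroʳ _)))
      (+-identityʳ _)

    σc⊆σv⇒x≋0 : ∀ x → σ c ⊆ σ (v x) → x ≋ (λ _ → 0#)
    σc⊆σv⇒x≋0 x σc⊆σv = multiple⇒x≋0 (maximal (v∈C x) σc⊆σv)
      where
      multiple⇒x≋0 : ∃[ u ] v x ≋ u · c → x ≋ (λ _ → 0#)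
      multiple⇒x≋0 (u , v≋uc) = d-independent x λ i → +-cancelˡ (c i) _ _ (begin
        v x i     ≈⟨ v≋uc i ⟩
        -- Both words have the same nonzero entry at `j`, which forces the scalar `u` to be one.
        u * c i   ≈⟨ *-congʳ (xy≈y⇒x≈1 cⱼ≉0 (trans (sym (v≋uc j)) (vⱼ≈cⱼ x))) ⟩
        1# * c i  ≈⟨ *-identityˡ _ ⟩
        c i       ≈⟨ +-identityʳ _ ⟨
        c i + 0#  ∎)

    -- Chosen so that `⟦ entry i ⟧ x` is `v x i` by definition.
    entry : Fin n → Form m
    entry i = c i , λ s → d s i

    entries : List (Form m)
    entries = map entry (elements (σ c ∖ j))

    -- If the product is nonzero, `v x` has no zero on the support of `c` away from `j`, nor at `j`,
    -- where it agrees with `c`. Maximality then leaves only the origin.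
    entries-vanish : ∀ x → ¬ x ≋ (λ _ → 0#) → ∏ entries x ≈ 0#
    entries-vanish x x≉0 = decidable-stable (∏ entries x ≈? 0#) λ ∏≉0 →
      x≉0 (σc⊆σv⇒x≋0 x λ {i} → σc⊆σv (Allₚ.map⁻ (∏-nonzero⁻ entries ∏≉0)) i)
      where
      σc⊆σv : All (λ i → ¬ v x i ≈ 0#) (elements (σ c ∖ j)) → ∀ i → i ∈ σ c → i ∈ σ (v x)
      σc⊆σv v≉0 i i∈σc = by-cases (i ≟ᶠ j)
        where
        by-cases : Dec (i ≡ j) → i ∈ σ (v x)
        by-cases (yes ≡.refl) = ∈σ⁺ (v x) (cⱼ≉0 ∘ trans (sym (vⱼ≈cⱼ x)))
        by-cases (no  i≢j)    =
          ∈σ⁺ (v x) (All.lookup v≉0 (∈-elements⁺ (x∈p∧x≢y⇒x∈p-y i∈σc i≢j)))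

    entries-at-0 : ¬ ∏ entries (λ _ → 0#) ≈ 0#
    entries-at-0 = ∏-nonzero⁺ (Allₚ.map⁺ (All.map nonzero-entry (elements-⊆ (σ c ∖ j))))
      where
      nonzero-entry : ∀ {i} → i ∈ σ c ∖ j → ¬ ⟦ entry i ⟧ (λ _ → 0#) ≈ 0#
      nonzero-entry {i} i∈ eq = ∈σ⁻ c (p─q⊆p (σ c) _ i∈) (begin
        c i         ≈⟨ +-identityʳ _ ⟨
        c i + 0#    ≈⟨ +-congˡ (sum-zero (λ s → 0# * d s i) λ s → zeroˡ _) ⟨
        ⟦ entry i ⟧ (λ _ → 0#) ≈⟨ eq ⟩
        0#          ∎)

    -- The enumeration may start at any element; translating it puts zero first, as the covering
    -- bound demands.
    grid : Vector Carrier (suc N)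
    grid i = from i - from zero

    grid-injective : Injective _≡_ _≈_ grid
    grid-injective eq = from-injective (+-cancelʳ _ _ _ eq)

    support-bound : m ℕ.* N ≤ ∣ σ c ∖ j ∣
    support-bound = ≡.subst (m ℕ.* N ≤_)
      (≡.trans (length-map entry (elements (σ c ∖ j))) (length-elements (σ c ∖ j)))
      (punctured-cover-bound grid grid-injective (-‿inverseʳ _) m entries
        entries-vanish entries-at-0)

-- From the support bound to the set `I` and the codeword `z`.

open import Data.Fin.Subset using (_-_)
open import Data.Nat.Base using (_*_)

theorem2p13 : {a ℓ₁ ℓ₂ p : Level} (q : ℕ) → PrimePower q →
    (𝔽 : FiniteField a ℓ₁ ℓ₂ q) → let open Codes 𝔽 in
    (n k : ℕ) → n ≥ k → k ≥ 1 →
    (C : Code n k p) (c : Word n) → Maximal C c →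
    (j : Fin n) → j ∈ σ c →
    Σ[ I ∈ Subset n ] Σ[ z ∈ Word n ]
    (I ⊆ σ c - j × ∣ I ∣ ≡ (q ∸ 1) * (k ∸ 1) × z ∈ᶜ C × I ⊆ σ z ∩ σ c)
-- A field has the element `0#`, which cannot be enumerated by the empty `Fin zero`.
theorem2p13 zero _ 𝔽 _ _ _ _ _ _ _ _ _
  with () ← Inverse.to (FiniteField.enumeration 𝔽)
              (CommutativeRing.0# (FiniteField.commutativeRing 𝔽))
-- Here `N` and `m` are what `q ∸ 1` and `k ∸ 1` compute to.
theorem2p13 (suc N) _ 𝔽 n (suc m) _ _ C c c-max j j∈σc =
  let I , I⊆σc-j , ∣I∣ = subset-of-size (σ c - j) (N * m)
        (≡.subst (_≤ ∣ σ c - j ∣) (ℕ.*-comm m N) (support-bound C c c-max j j∈σc))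
  in I , c , I⊆σc-j , ∣I∣ , Maximal.codeword c-max ,
     λ i∈I → let i∈σc = p─q⊆p (σ c) _ (I⊆σc-j i∈I) in x∈p∩q⁺ (i∈σc , i∈σc)
  where
  open Codes 𝔽
  open SupportBound 𝔽
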